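{- For all integers $t \geq 3$ and $k \geq 3$ (and every positive integer $n$), $$\mathrm{ex}(n;\, C_k,\, K_{1,t}\text{ -ind}) \leq \frac{1}{2}(k-2)(t-1)\,n,$$ and, for each such $t$ and $k$, equality holds for infinitely many values of $n$.
   Context: All graphs are finite and simple. For graphs $H$ and $G$, $\mathrm{ex}(n;\, H,\, G\text{ -ind})$ denotes the maximum number of edges in an $n$-vertex graph that contains no subgraph (not necessarily induced) isomorphic to $H$ and no induced subgraph isomorphic to $G$. $C_k$ is the cycle of length $k$ and $K_{1,t}$ is the star with $t$ leaves. -}

module Defs where

open import Level using (0ℓ)
open import Data.Nat using (ℕ; suc; _≤_; s≤s)
import Data.Nat.Properties as ℕ
open import Data.Fin using (Fin; zero; toℕ)
open import Data.Fin.Properties using (_≟_; _<?_)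
open import Data.List using (length; filter; allFin; cartesianProduct)
open import Data.Product using (Σ-syntax; _×_; _,_)
open import Data.Sum using (_⊎_; inj₁; inj₂) renaming (swap to ⊎-swap)
open import Function using (_⇔_)
open import Function.Definitions using (Injective)
open import Relation.Binary using (Rel; Decidable; Symmetric; Irreflexive)
open import Relation.Binary.PropositionalEquality using (_≡_; _≢_; refl; sym; trans; cong)
open import Relation.Nullary using (¬_)
open import Relation.Nullary.Decidable using (¬?; _×-dec_; _⊎-dec_)

record Graph (n : ℕ) : Set₁ where
  infix 4 _~_ _~?_
  field
    _~_      : Rel (Fin n) 0ℓ
    _~?_     : Decidable _~_
    ~-sym    : Symmetric _~_
    ~-irrefl : Irreflexive _≡_ _~_

-- Each edge {i , j} is counted once, as the pair with i < j.
∣E_∣ : ∀ {n} → Graph n → ℕ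
∣E_∣ {n} Γ =
  length (filter (λ (i , j) → (i <? j) ×-dec (i ~? j))
                 (cartesianProduct (allFin n) (allFin n)))
  where open Graph Γ

module _ {m n : ℕ} (H : Graph m) (Γ : Graph n) where
  private
    module H = Graph H
    module Γ = Graph Γ

  ContainsSubgraph : Set
  ContainsSubgraph =
    Σ[ f ∈ (Fin m → Fin n) ]
      Injective _≡_ _≡_ f × (∀ u v → u H.~ v → f u Γ.~ f v)

  ContainsInduced : Set
  ContainsInduced =
    Σ[ f ∈ (Fin m → Fin n) ]
      Injective _≡_ _≡_ f × (∀ u v → u H.~ v ⇔ f u Γ.~ f v)

Free : ∀ {a b n} → Graph a → Graph b → Graph n → Set
Free H G Γ = ¬ ContainsSubgraph H Γ × ¬ ContainsInduced G Γ

-- IsEx n H G m says that ex(n; H, G-ind) = m.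
IsEx : ∀ {a b} → ℕ → Graph a → Graph b → ℕ → Set₁
IsEx n H G m =
  (Σ[ Γ ∈ Graph n ] Free H G Γ × ∣E Γ ∣ ≡ m) ×
  (∀ (Γ : Graph n) → Free H G Γ → ∣E Γ ∣ ≤ m)

-- j follows i in the cyclic order 0 , 1 , … , k - 1 , 0.
Next : ∀ {k} → Rel (Fin k) 0ℓ
Next {k} i j = (toℕ j ≡ suc (toℕ i)) ⊎ (suc (toℕ i) ≡ k × toℕ j ≡ 0)

next? : ∀ {k} → Decidable (Next {k})
next? {k} i j =
  (toℕ j ℕ.≟ suc (toℕ i)) ⊎-dec ((suc (toℕ i) ℕ.≟ k) ×-dec (toℕ j ℕ.≟ 0))

next-irrefl : ∀ {k} → 3 ≤ k → ∀ (i : Fin k) → ¬ Next i i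
next-irrefl _   i (inj₁ i≡1+i) = ℕ.1+n≢n (sym i≡1+i)
next-irrefl 3≤k i (inj₂ (1+i≡k , i≡0))
  with s≤s () ← ℕ.≤-trans 3≤k (ℕ.≤-reflexive (trans (sym 1+i≡k) (cong suc i≡0)))

C : ∀ k → 3 ≤ k → Graph k
C k 3≤k = record
  { _~_      = λ i j → Next i j ⊎ Next j i
  ; _~?_     = λ i j → next? i j ⊎-dec next? j i
  ; ~-sym    = ⊎-swap
  ; ~-irrefl = λ { {i} refl (inj₁ p) → next-irrefl 3≤k i p
                 ; {i} refl (inj₂ p) → next-irrefl 3≤k i p }
  }

-- The star K_{1,t}: vertex zero is the centre, the other t vertices are leaves.
K₁ : ∀ t → Graph (suc t)
K₁ t = record
  { _~_      = λ i j → (i ≡ zero × j ≢ zero) ⊎ (j ≡ zero × i ≢ zero)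
  ; _~?_     = λ i j → ((i ≟ zero) ×-dec ¬? (j ≟ zero)) ⊎-dec
                       ((j ≟ zero) ×-dec ¬? (i ≟ zero))
  ; ~-sym    = ⊎-swap
  ; ~-irrefl = λ { refl (inj₁ (p , ¬p)) → ¬p p ; refl (inj₂ (p , ¬p)) → ¬p p }
  }

{-# OPTIONS --safe #-}

-- Upper bound: a longest path in a set of vertices contains all neighbours of
-- its end inside the set.  Hence, if N(v) has no path on k - 1 vertices,
-- repeatedly removing a longest path, of at most k - 2 vertices, and keeping its
-- end yields an independent set of size at least deg v / (k - 2).  So
-- deg v ≤ (k - 2)(t - 1), and the bound on the edges is the handshake lemma.
--
-- Equality: let t - 1 copies of the cyclic group of order k - 1 act on a finite
-- set so that no nonempty reduced word of length at most k in their free product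
-- has a fixed point, and join two points when they lie in a common orbit of one
-- of the copies.  Every vertex lies in t - 1 cliques of size k - 1, the other
-- vertices of these cliques are pairwise distinct, and a cycle of length k would
-- spell a short reduced word with a fixed point.  Such actions arise from a
-- trivial action by iterating a covering construction.
module Submission where

import Algebra.Properties.CommutativeMonoid.Sum as Sum
open import Data.Bool using (Bool; true; if_then_else_)
import Data.Bool.Properties as Bool
open import Data.Empty using (⊥)
open import Data.Fin as Fin using (Fin; zero; suc; toℕ; fromℕ<; remQuot)
open import Data.Fin.Properties using (_≟_; _<?_; <-cmp; <-asym; <⇒≢; suc-injective; toℕ<n; toℕ-injective; toℕ-fromℕ<; nonZeroIndex; injective⇒≤; pigeonhole; any?; all?; *↔×; 1↔⊤; 2↔Bool)
open import Data.List using (List; []; _∷_; _++_; length; lookup; filter; allFin; tabulate; cartesianProduct; map)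
open import Data.List.Properties using (filter-++; filter-≐; length-++; map-tabulate)
open import Data.List.Membership.Propositional using (_∈_; find)
open import Data.List.Membership.Propositional.Properties using (∈-∃++; ∈-lookup; ∈-filter⁺; ∈-allFin)
open import Data.List.Relation.Binary.Permutation.Propositional using (_↭_; ↭-refl; ↭-sym; ↭-trans; ↭⇒↭ₛ; prep)
open import Data.List.Relation.Binary.Permutation.Propositional.Properties using (All-resp-↭; ↭-length; shift; shifts; ++⁺ˡ)
open import Data.List.Relation.Binary.Permutation.Setoid.Properties using (Unique-resp-↭)
open import Data.List.Relation.Unary.All as All using (All; []; _∷_)
open import Data.List.Relation.Unary.All.Properties using (++⁻ˡ; ¬Any⇒All¬; all-filter)
open import Data.List.Relation.Unary.AllPairs using (AllPairs; []; _∷_)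
import Data.List.Relation.Unary.Any as Any
open import Data.List.Relation.Unary.Any.Properties using (lookup-index)
open import Data.List.Relation.Unary.Linked using (Linked; [-]; _∷_)
open import Data.List.Relation.Unary.Unique.Propositional using (Unique)
open import Data.List.Relation.Unary.Unique.Propositional.Properties using (allFin⁺; filter⁺)
open import Data.Nat using (ℕ; zero; suc; _+_; _*_; _∸_; _≤_; _<_; z≤n; s≤s; _%_; _/_)
open import Data.Nat.DivMod using (_mod_; m%n<n; m<n⇒m%n≡m; n%n≡0; [m+n]%n≡m%n; %-distribˡ-+; m%n%n≡m%n; m≡m%n+[m/n]*n)
import Data.Nat.Properties as ℕ
open import Data.Product as Product using (Σ-syntax; ∃; ∃-syntax; _×_; _,_; proj₁; proj₂; uncurry)
open import Data.Product.Function.NonDependent.Propositional using (_×-↔_)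
open import Data.Sum as ⊎ using (_⊎_; inj₁; inj₂)
open import Data.Unit using (⊤; tt)
open import Data.Vec as Vec using (Vec; []; _∷_)
open import Data.Vec.Properties using (lookup∘tabulate; lookup∘updateAt; lookup∘updateAt′; updateAt-updateAt; updateAt-updateAt-local; updateAt-id-local)
open import Function using (_∘_; id; const; _⇔_; _↔_; mk⇔; mk↔ₛ′; Equivalence; Injection; Inverse)
open import Function.Construct.Composition using (_⇔-∘_; _↔-∘_)
open import Function.Construct.Identity using (↔-id)
open import Function.Construct.Symmetry using (⇔-sym; ↔-sym)
open import Function.Definitions using (Injective)
open import Function.Properties.Inverse using (↔⇒↣)
open import Relation.Binary using (Symmetric; tri<; tri≈; tri>) renaming (Decidable to Decidable₂)
open import Relation.Binary.PropositionalEquality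
open import Relation.Nullary using (¬_; Dec; yes; no; does; contradiction)
open import Relation.Nullary.Decidable using (map′; ¬?; _×-dec_; _⊎-dec_; _→-dec_; dec-true; via-injection)
open import Relation.Unary using (Decidable)
open import Defs

open Sum ℕ.+-0-commutativeMonoid using (sum; sum-cong-≗; ∑-distrib-+; ∑-comm)

-- Finite types

Finite : Set → Set
Finite A = ∃[ n ] A ↔ Fin n

×-finite : ∀ {A B} → Finite A → Finite B → Finite (A × B)
×-finite (m , f) (n , g) = m * n , ↔-sym *↔× ↔-∘ (f ×-↔ g)

Vec-finite : ∀ {A} → Finite A → ∀ n → Finite (Vec A n)
Vec-finite A-finite zero = 1 , ↔-sym 1↔⊤ ↔-∘
  mk↔ₛ′ (const tt) (const []) (λ _ → refl) λ { [] → refl }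
Vec-finite A-finite (suc n)
  with m , f ← ×-finite A-finite (Vec-finite A-finite n) =
  m , f ↔-∘ mk↔ₛ′ Vec.uncons (uncurry _∷_) (λ _ → refl) λ { (x ∷ xs) → refl }

-- Counting edges

indicator : ∀ {P : Set} → Dec P → ℕ
indicator P? = if does P? then 1 else 0

-- A truth table, meant for splitting an adjacency by the order of its ends: `A` and `B` are the two
-- strict orders, `P` and `Q` the adjacency read in both directions. The first four clauses are the
-- inconsistent assignments.
indicator-split : ∀ {A B P Q : Set} (A? : Dec A) (B? : Dec B) (P? : Dec P) (Q? : Dec Q) →
  (A → ¬ B) → (P → A ⊎ B) → (P → Q) → (Q → P) →
  indicator P? ≡ indicator (A? ×-dec P?) + indicator (B? ×-dec Q?)
indicator-split (yes a) (yes b) _       _       A⇒¬B _    _   _   = contradiction b (A⇒¬B a)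
indicator-split _       _       (yes p) (no ¬q) _    _    P⇒Q _   = contradiction (P⇒Q p) ¬q
indicator-split _       _       (no ¬p) (yes q) _    _    _   Q⇒P = contradiction (Q⇒P q) ¬p
indicator-split (no ¬a) (no ¬b) (yes p) _       _    P⇒AB _   _   = contradiction (P⇒AB p) ⊎.[ ¬a , ¬b ]
indicator-split (yes _) (no _)  (yes _) (yes _) _    _    _   _   = refl
indicator-split (no _)  (yes _) (yes _) (yes _) _    _    _   _   = refl
indicator-split (yes _) (no _)  (no _)  (no _)  _    _    _   _   = refl
indicator-split (no _)  (yes _) (no _)  (no _)  _    _    _   _   = refl
indicator-split (no _)  (no _)  (no _)  (no _)  _    _    _   _   = refl

module _ {A : Set} {P : A → Set} (P? : Decidable P) where

  length-filter-tabulate : ∀ {n} (f : Fin n → A) →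
    length (filter P? (tabulate f)) ≡ sum (λ i → indicator (P? (f i)))
  length-filter-tabulate {zero}  f = refl
  length-filter-tabulate {suc n} f with ih ← length-filter-tabulate (f ∘ suc) | P? (f zero)
  ... | yes _ = cong suc ih
  ... | no  _ = ih

length-filter-cartesianProduct : ∀ {A B : Set} {P : A × B → Set} (P? : Decidable P)
  {m n} (f : Fin m → A) (g : Fin n → B) →
  length (filter P? (cartesianProduct (tabulate f) (tabulate g))) ≡
  sum (λ i → sum (λ j → indicator (P? (f i , g j))))
length-filter-cartesianProduct P? {zero} f g = refl
length-filter-cartesianProduct P? {suc m} f g = begin
  length (filter P? (row ++ rest))                     ≡⟨ cong length (filter-++ P? row rest) ⟩
  length (filter P? row ++ filter P? rest)             ≡⟨ length-++ (filter P? row) ⟩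
  length (filter P? row) + length (filter P? rest)     ≡⟨ cong₂ _+_
    (trans (cong (length ∘ filter P?) (map-tabulate g (f zero ,_)))
           (length-filter-tabulate P? ((f zero ,_) ∘ g)))
    (length-filter-cartesianProduct P? (f ∘ suc) g) ⟩
  sum (λ i → sum (λ j → indicator (P? (f i , g j))))   ∎
  where
  open ≡-Reasoning
  row  = map (f zero ,_) (tabulate g)
  rest = cartesianProduct (tabulate (f ∘ suc)) (tabulate g)

sum-≤ : ∀ {n c} (f : Fin n → ℕ) → (∀ i → f i ≤ c) → sum f ≤ n * c
sum-≤ {zero}  f f≤c = z≤n
sum-≤ {suc n} f f≤c = ℕ.+-mono-≤ (f≤c zero) (sum-≤ (f ∘ suc) (f≤c ∘ suc))

sum-≥ : ∀ {n c} (f : Fin n → ℕ) → (∀ i → c ≤ f i) → n * c ≤ sum f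
sum-≥ {zero}  f c≤f = z≤n
sum-≥ {suc n} f c≤f = ℕ.+-mono-≤ (c≤f zero) (sum-≥ (f ∘ suc) (c≤f ∘ suc))

injection⇒≤length : ∀ {A : Set} {m} {xs : List A} (f : Fin m → A) →
  Injective _≡_ _≡_ f → (∀ i → f i ∈ xs) → m ≤ length xs
injection⇒≤length {xs = xs} f f-injective f∈xs =
  injective⇒≤ {f = Any.index ∘ f∈xs} λ {i} {j} eq → f-injective (begin
    f i                                  ≡⟨ lookup-index (f∈xs i) ⟩
    lookup xs (Any.index (f∈xs i))       ≡⟨ cong (lookup xs) eq ⟩
    lookup xs (Any.index (f∈xs j))       ≡⟨ lookup-index (f∈xs j) ⟨
    f j                                  ∎)
  where open ≡-Reasoning

module Degree {n} (Γ : Graph n) where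
  open Graph Γ

  neighbours : Fin n → List (Fin n)
  neighbours v = filter (v ~?_) (allFin n)

  degree : Fin n → ℕ
  degree v = length (neighbours v)

  private
    adjacent ascending : Fin n → Fin n → ℕ
    adjacent i j = indicator (i ~? j)
    ascending i j = indicator ((i <? j) ×-dec (i ~? j))

  adjacent-split : ∀ i j → adjacent i j ≡ ascending i j + ascending j i
  adjacent-split i j = indicator-split (i <? j) (j <? i) (i ~? j) (j ~? i)
    <-asym comparable ~-sym ~-sym
    where
    comparable : i ~ j → i Fin.< j ⊎ j Fin.< i
    comparable i~j with <-cmp i j
    ... | tri< i<j _ _ = inj₁ i<j
    ... | tri≈ _ i≡j _ = contradiction i~j (~-irrefl i≡j)
    ... | tri> _ _ j<i = inj₂ j<i

  -- Both sides count ordered adjacent pairs: each pair is ascending or descending, and exchanging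
  -- the summations turns the descending ones into ascending ones.
  handshake : sum degree ≡ 2 * ∣E Γ ∣
  handshake = begin
    sum degree
      ≡⟨ sum-cong-≗ (λ i → length-filter-tabulate (i ~?_) id) ⟩
    sum (λ i → sum (adjacent i))
      ≡⟨ sum-cong-≗ (λ i → sum-cong-≗ (adjacent-split i)) ⟩
    sum (λ i → sum (λ j → ascending i j + ascending j i))
      ≡⟨ sum-cong-≗ (λ i → ∑-distrib-+ (ascending i) (λ j → ascending j i)) ⟩
    sum (λ i → sum (ascending i) + sum (λ j → ascending j i))
      ≡⟨ ∑-distrib-+ (λ i → sum (ascending i)) (λ i → sum (λ j → ascending j i)) ⟩
    total + sum (λ i → sum (λ j → ascending j i))
      ≡⟨ cong (total +_) (∑-comm ascending) ⟨
    total + total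
      ≡⟨ cong (total +_) (ℕ.+-identityʳ total) ⟨
    2 * total
      ≡⟨ cong (2 *_) (length-filter-cartesianProduct (λ (i , j) → (i <? j) ×-dec (i ~? j)) id id) ⟨
    2 * ∣E Γ ∣ ∎
    where
    open ≡-Reasoning
    total = sum (λ i → sum (ascending i))

-- The upper bound

AllPairs-++⁻ˡ : ∀ {A : Set} {R : A → A → Set} xs {ys} → AllPairs R (xs ++ ys) → AllPairs R xs
AllPairs-++⁻ˡ []       _          = []
AllPairs-++⁻ˡ (x ∷ xs) (px ∷ pxs) = ++⁻ˡ xs px ∷ AllPairs-++⁻ˡ xs pxs

AllPairs-lookup : ∀ {A : Set} {R : A → A → Set} {xs} → Symmetric R → AllPairs R xs →
  ∀ i j → i ≢ j → R (lookup xs i) (lookup xs j)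
AllPairs-lookup R-sym (px ∷ pxs) zero    zero    i≢j = contradiction refl i≢j
AllPairs-lookup R-sym (px ∷ pxs) zero    (suc j) i≢j = All.lookup px (∈-lookup j)
AllPairs-lookup R-sym (px ∷ pxs) (suc i) zero    i≢j = R-sym (All.lookup px (∈-lookup i))
AllPairs-lookup R-sym (px ∷ pxs) (suc i) (suc j) i≢j =
  AllPairs-lookup R-sym pxs i j (i≢j ∘ cong suc)

Unique⇒lookup-injective : ∀ {A : Set} {xs : List A} → Unique xs →
  ∀ {i j} → lookup xs i ≡ lookup xs j → i ≡ j
Unique⇒lookup-injective {xs = xs} xs! {i} {j} eq with i ≟ j
... | yes i≡j = i≡j
... | no  i≢j = contradiction eq (AllPairs-lookup (λ x≢y → x≢y ∘ sym) xs! i j i≢j)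

Linked-lookup : ∀ {A : Set} {R : A → A → Set} {xs} → Linked R xs →
  ∀ i j → toℕ j ≡ suc (toℕ i) → R (lookup xs i) (lookup xs j)
Linked-lookup [-]        zero    (suc ()) _
Linked-lookup (Rxy ∷ _)  zero    (suc zero) _ = Rxy
Linked-lookup (_ ∷ Rxs)  (suc i) (suc j)    eq = Linked-lookup Rxs i j (ℕ.suc-injective eq)

reinsert : ∀ {A : Set} (w : A) vs ys zs → w ∷ vs ++ ys ++ zs ↭ vs ++ ys ++ w ∷ zs
reinsert w vs ys zs = ↭-trans (↭-sym (shift w vs (ys ++ zs))) (++⁺ˡ vs (↭-sym (shift w ys zs)))

-- Greedy paths and independent sets

module _ {A : Set} {_~_ : A → A → Set} (_~?_ : Decidable₂ _~_) (~-sym : Symmetric _~_) where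

  -- The remainder `rs` and the permutation make the path a selection of entries of `xs`, so
  -- distinctness and any property shared by all entries of `xs` pass to it.
  HasPath : ℕ → List A → Set
  HasPath q xs = ∃[ ps ] ∃[ rs ] Linked _~_ ps × length ps ≡ q × ps ++ rs ↭ xs

  HasIndependent : ℕ → List A → Set
  HasIndependent q xs = ∃[ js ] ∃[ rs ] AllPairs (λ x y → ¬ (x ~ y)) js × length js ≡ q × js ++ rs ↭ xs

  -- The path is prolonged greedily at its head, and `a` counts the vertices that it still lacks to
  -- have `q + 1`. If growth stops earlier, the head has no neighbour among the vertices left over.
  grow : ∀ {q} a v ps rs → Linked _~_ (v ∷ ps) → a + length (v ∷ ps) ≡ suc q →
    HasPath (suc q) (v ∷ ps ++ rs) ⊎
    (∃[ v′ ] ∃[ ps′ ] ∃[ rs′ ] length (v′ ∷ ps′) ≤ q × All (λ x → ¬ (v′ ~ x)) rs′ ×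
      v′ ∷ ps′ ++ rs′ ↭ v ∷ ps ++ rs)
  grow zero    v ps rs path eq = inj₁ (v ∷ ps , rs , path , eq , ↭-refl)
  grow (suc a) v ps rs path eq with Any.any? (v ~?_) rs
  ... | no stuck = inj₂ (v , ps , rs , ℕ.m+n≤o⇒n≤o a (ℕ.≤-reflexive (ℕ.suc-injective eq)) ,
                         ¬Any⇒All¬ rs stuck , ↭-refl)
  ... | yes v~rs with w , w∈rs , v~w ← find v~rs
                 with ys , zs , refl ← ∈-∃++ w∈rs
                 with grow a w (v ∷ ps) (ys ++ zs) (~-sym v~w ∷ path) (trans (ℕ.+-suc a _) eq)
  ...   | inj₁ (ps′ , rs′ , path′ , eq′ , perm) =
            inj₁ (ps′ , rs′ , path′ , eq′ , ↭-trans perm (reinsert w (v ∷ ps) ys zs))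
  ...   | inj₂ (v′ , ps′ , rs′ , short , stuck , perm) =
            inj₂ (v′ , ps′ , rs′ , short , stuck , ↭-trans perm (reinsert w (v ∷ ps) ys zs))

  -- The end of a path that cannot be prolonged has all its neighbours on the path.
  path-or-independent : ∀ q s xs → q * s < length xs →
    HasPath (suc q) xs ⊎ HasIndependent (suc s) xs
  path-or-independent q zero    (x ∷ xs) _ =
    inj₂ (x ∷ [] , xs , [] ∷ [] , refl , ↭-refl)
  path-or-independent q (suc s) (x ∷ xs) big
    with grow q x [] xs [-] (ℕ.+-comm q 1)
  ... | inj₁ path = inj₁ path
  ... | inj₂ (v , ps , rs , short , stuck , perm)
      -- At most `q` vertices lie on the path, so more than `q * s` are left over.
      with path-or-independent q s rs (ℕ.+-cancelˡ-< q _ _ (begin-strict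
        q + q * s                  ≡⟨ ℕ.*-suc q s ⟨
        q * suc s                  <⟨ big ⟩
        length (x ∷ xs)            ≡⟨ ↭-length perm ⟨
        length (v ∷ ps ++ rs)      ≡⟨ length-++ (v ∷ ps) ⟩
        length (v ∷ ps) + length rs ≤⟨ ℕ.+-monoˡ-≤ (length rs) short ⟩
        q + length rs              ∎))
    where open ℕ.≤-Reasoning
  ...   | inj₁ (ps′ , rs′ , path , eq , perm′) =
            inj₁ (ps′ , v ∷ ps ++ rs′ , path , eq ,
              ↭-trans (↭-trans (shifts ps′ (v ∷ ps)) (++⁺ˡ (v ∷ ps) perm′)) perm)
  ...   | inj₂ (js , rs′ , indep , eq , perm′) =
            inj₂ (v ∷ js , ps ++ rs′ , ++⁻ˡ js (All-resp-↭ (↭-sym perm′) stuck) ∷ indep , cong suc eq ,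
              ↭-trans (prep v (↭-trans (shifts js ps) (++⁺ˡ ps perm′))) perm)

-- Cycles and stars around a vertex

module _ {n} (Γ : Graph n) where
  open Graph Γ
  open Degree Γ

  -- The cycle runs from `v` along the path and back. Both edges at `v`, the closing one included,
  -- exist because `v` is adjacent to the whole path.
  cone-cycle : ∀ v ps → Unique (v ∷ ps) → All (v ~_) ps → Linked _~_ ps →
    ∀ {k} → length (v ∷ ps) ≡ k → (3≤k : 3 ≤ k) → ContainsSubgraph (C k 3≤k) Γ
  cone-cycle v []       _      _            _    refl (s≤s ())
  cone-cycle v (p ∷ ps) unique (v~p ∷ v~ps) path refl 3≤k =
    lookup (v ∷ p ∷ ps) , Unique⇒lookup-injective unique , adjacent
    where
    next : ∀ i j → Next {length (v ∷ p ∷ ps)} i j → lookup (v ∷ p ∷ ps) i ~ lookup (v ∷ p ∷ ps) j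
    next i j (inj₁ eq) = Linked-lookup (v~p ∷ path) i j eq
    next zero    zero (inj₂ (() , _))
    next (suc i) zero (inj₂ _) = ~-sym (All.lookup (v~p ∷ v~ps) (∈-lookup i))
    adjacent : ∀ i j → _ → _
    adjacent i j (inj₁ nx) = next i j nx
    adjacent i j (inj₂ nx) = ~-sym (next j i nx)

  independent-star : ∀ v js → Unique (v ∷ js) → All (v ~_) js →
    AllPairs (λ x y → ¬ (x ~ y)) js →
    ∀ {t} → length js ≡ t → ContainsInduced (K₁ t) Γ
  independent-star v js unique v~js indep refl =
    lookup (v ∷ js) , Unique⇒lookup-injective unique , λ i j → mk⇔ (to i j) (from i j)
    where
    to : ∀ i j → _ → lookup (v ∷ js) i ~ lookup (v ∷ js) j
    to zero    zero    (inj₁ (_ , ≢0)) = contradiction refl ≢0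
    to zero    zero    (inj₂ (_ , ≢0)) = contradiction refl ≢0
    to zero    (suc j) _ = All.lookup v~js (∈-lookup j)
    to (suc i) zero    _ = ~-sym (All.lookup v~js (∈-lookup i))
    to (suc i) (suc j) (inj₁ (() , _))
    to (suc i) (suc j) (inj₂ (() , _))
    from : ∀ i j → lookup (v ∷ js) i ~ lookup (v ∷ js) j → Graph._~_ (K₁ (length js)) i j
    from zero    zero    v~v = contradiction v~v (~-irrefl refl)
    from zero    (suc j) _   = inj₁ (refl , λ ())
    from (suc i) zero    _   = inj₂ (refl , λ ())
    from (suc i) (suc j) i~j with i ≟ j
    ... | yes refl = contradiction i~j (~-irrefl refl)
    ... | no i≢j   = contradiction i~j (AllPairs-lookup (λ ¬x~y → ¬x~y ∘ ~-sym) indep i j i≢j)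

  -- Here `k = q + 2` and `t = s + 1`. With more than `q * s` neighbours, `v` would have among them
  -- either a path on `k - 1` vertices, closed by `v` to a `k`-cycle, or `t` independent vertices,
  -- the leaves of an induced star.
  degree-≤ : ∀ q s (3≤k : 3 ≤ suc (suc q)) → Free (C (suc (suc q)) 3≤k) (K₁ (suc s)) Γ →
    ∀ v → degree v ≤ q * s
  degree-≤ q s 3≤k (noC , noK) v = ℕ.≮⇒≥ λ big → absurd (path-or-independent _~?_ ~-sym q s (neighbours v) big)
    where
    v~ns : All (v ~_) (neighbours v)
    v~ns = all-filter (v ~?_) (allFin n)
    prefix : ∀ xs {ys} → xs ++ ys ↭ neighbours v → All (v ~_) xs × Unique (v ∷ xs)
    prefix xs perm = v~xs , All.map (λ v~x v≡x → ~-irrefl v≡x v~x) v~xs ∷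
      AllPairs-++⁻ˡ xs (Unique-resp-↭ (setoid _) (↭⇒↭ₛ (↭-sym perm)) (filter⁺ (v ~?_) (allFin⁺ n)))
      where v~xs = ++⁻ˡ xs (All-resp-↭ (↭-sym perm) v~ns)
    absurd : ¬ (HasPath _~?_ ~-sym (suc q) (neighbours v) ⊎ HasIndependent _~?_ ~-sym (suc s) (neighbours v))
    absurd (inj₁ (ps , _ , path , eq , perm)) with v~ps , unique ← prefix ps perm =
      noC (cone-cycle v ps unique v~ps path (cong suc eq) 3≤k)
    absurd (inj₂ (js , _ , indep , eq , perm)) with v~js , unique ← prefix js perm =
      noK (independent-star v js unique v~js indep eq)

  edges-≤ : ∀ q s (3≤k : 3 ≤ suc (suc q)) → Free (C (suc (suc q)) 3≤k) (K₁ (suc s)) Γ →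
    2 * ∣E Γ ∣ ≤ q * s * n
  edges-≤ q s 3≤k free = begin
    2 * ∣E Γ ∣      ≡⟨ handshake ⟨
    _               ≤⟨ sum-≤ degree (degree-≤ q s 3≤k free) ⟩
    n * (q * s)     ≡⟨ ℕ.*-comm n (q * s) ⟩
    q * s * n       ∎
    where open ℕ.≤-Reasoning

-- Attaining the maximum

∃? : ∀ {A : Set} {P : A → Set} → Finite A → Decidable P → Dec (∃ P)
∃? {P = P} (n , f) P? = map′
  (Product.map (Inverse.from f) id)
  (λ (x , p) → Inverse.to f x , subst P (sym (Inverse.strictlyInverseʳ f x)) p)
  (any? (P? ∘ Inverse.from f))

module _ {m n} {R : Fin m → Fin m → Fin n → Fin n → Set}
         (R? : ∀ u v x y → Dec (R u v x y)) where

  -- The relation `R` covers both kinds of containment: an implication between adjacencies for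
  -- subgraphs, an equivalence for induced subgraphs.
  Embedding : (Fin m → Fin n) → Set
  Embedding f = Injective _≡_ _≡_ f × (∀ u v → R u v (f u) (f v))

  private
    embedding? : Decidable Embedding
    embedding? f =
      map′ (λ inj {x} {y} → inj x y) (λ inj x y → inj {x} {y})
           (all? λ x → all? λ y → (f x ≟ f y) →-dec (x ≟ y))
      ×-dec (all? λ u → all? λ v → R? u v (f u) (f v))

    embedding-cong : ∀ {f g} → f ≗ g → Embedding f → Embedding g
    embedding-cong f≗g (inj , hom) =
      (λ {x} {y} eq → inj (trans (f≗g x) (trans eq (sym (f≗g y))))) ,
      (λ u v → subst₂ (R u v) (f≗g u) (f≗g v) (hom u v))

  ∃-embedding? : Dec (∃ Embedding)
  ∃-embedding? = map′
    (λ (xs , emb) → Vec.lookup xs , emb)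
    -- Only finitely many tables are searched; `f` agrees with its table pointwise, which is enough.
    (λ (f , emb) → Vec.tabulate f , embedding-cong (λ i → sym (lookup∘tabulate f i)) emb)
    (∃? (Vec-finite (n , ↔-id _) m) (embedding? ∘ Vec.lookup))

free? : ∀ {a b n} (H : Graph a) (G : Graph b) (Γ : Graph n) → Dec (Free H G Γ)
free? H G Γ =
  ¬? (∃-embedding? λ u v x y → (u H.~? v) →-dec (x Γ.~? y)) ×-dec
  ¬? (∃-embedding? λ u v x y → map′ (λ (f , g) → mk⇔ f g) (λ e → Equivalence.to e , Equivalence.from e)
        (((u G.~? v) →-dec (x Γ.~? y)) ×-dec ((x Γ.~? y) →-dec (u G.~? v))))
  where
  module H = Graph H
  module G = Graph G
  module Γ = Graph Γ

-- Graphs up to equivalent adjacency, and Boolean matrices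

_≈_ : ∀ {n} → Graph n → Graph n → Set
Γ ≈ Δ = ∀ i j → Graph._~_ Γ i j ⇔ Graph._~_ Δ i j

Free-resp-≈ : ∀ {a b n} {H : Graph a} {G : Graph b} {Γ Δ : Graph n} →
  Γ ≈ Δ → Free H G Γ → Free H G Δ
Free-resp-≈ Γ≈Δ (noH , noG) =
  (λ (f , inj , hom) → noH (f , inj , λ u v → Equivalence.from (Γ≈Δ _ _) ∘ hom u v)) ,
  (λ (f , inj , emb) → noG (f , inj , λ u v → ⇔-sym (Γ≈Δ _ _) ⇔-∘ emb u v))

∣E∣-cong : ∀ {n} {Γ Δ : Graph n} → Γ ≈ Δ → ∣E Γ ∣ ≡ ∣E Δ ∣
∣E∣-cong {n} {Γ} {Δ} Γ≈Δ = cong length (filter-≐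
  (λ (i , j) → (i <? j) ×-dec Graph._~?_ Γ i j)
  (λ (i , j) → (i <? j) ×-dec Graph._~?_ Δ i j)
  ((λ (i<j , i~j) → i<j , Equivalence.to (Γ≈Δ _ _) i~j) ,
   (λ (i<j , i~j) → i<j , Equivalence.from (Γ≈Δ _ _) i~j))
  (cartesianProduct (allFin n) (allFin n)))

Matrix : ℕ → Set
Matrix n = Vec (Vec Bool n) n

Matrix-finite : ∀ n → Finite (Matrix n)
Matrix-finite n = Vec-finite (Vec-finite (2 , ↔-sym 2↔Bool) n) n

-- Symmetrising and dropping the diagonal makes every matrix a graph, so the search may run over all
-- matrices.
fromMatrix : ∀ {n} → Matrix n → Graph n
fromMatrix M = record
  { _~_      = λ i j → i ≢ j × (entry i j ≡ true ⊎ entry j i ≡ true)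
  ; _~?_     = λ i j → ¬? (i ≟ j) ×-dec ((entry i j Bool.≟ true) ⊎-dec (entry j i Bool.≟ true))
  ; ~-sym    = λ (i≢j , e) → (i≢j ∘ sym) , ⊎.swap e
  ; ~-irrefl = λ i≡j (i≢j , _) → i≢j i≡j
  }
  where entry = λ i j → Vec.lookup (Vec.lookup M i) j

toMatrix : ∀ {n} → Graph n → Matrix n
toMatrix Γ = Vec.tabulate λ i → Vec.tabulate λ j → does (Graph._~?_ Γ i j)

toMatrix-≈ : ∀ {n} (Γ : Graph n) → Γ ≈ fromMatrix (toMatrix Γ)
toMatrix-≈ Γ i j = mk⇔
  (λ i~j → (λ i≡j → ~-irrefl i≡j i~j) , inj₁ (trans (entry i j) (dec-true (i ~? j) i~j)))
  λ (_ , e) → ⊎.[ present i j , ~-sym ∘ present j i ] e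
  where
  open Graph Γ
  entry : ∀ i j → Vec.lookup (Vec.lookup (toMatrix Γ) i) j ≡ does (i ~? j)
  entry i j = trans (cong (λ row → Vec.lookup row j) (lookup∘tabulate _ i)) (lookup∘tabulate _ j)
  present : ∀ i j → Vec.lookup (Vec.lookup (toMatrix Γ) i) j ≡ true → i ~ j
  present i j e with i ~? j | entry i j
  ... | yes i~j | _  = i~j
  ... | no _    | e′ = contradiction (trans (sym e) e′) λ ()

-- The bound is lowered until it is attained. Attainment is decidable because, up to `≈`, every
-- graph comes from one of finitely many matrices; at bound 0 the given graph attains it.
maximum-exists : ∀ {a b n} (H : Graph a) (G : Graph b) (Γ₀ : Graph n) → Free H G Γ₀ →
  ∀ B → (∀ Γ → Free H G Γ → ∣E Γ ∣ ≤ B) → ∃[ m ] IsEx n H G m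
maximum-exists H G Γ₀ free₀ zero bound =
  0 , (Γ₀ , free₀ , ℕ.n≤0⇒n≡0 (bound Γ₀ free₀)) , bound
maximum-exists {n = n} H G Γ₀ free₀ (suc B) bound
  with ∃? (Matrix-finite n) (λ M → free? H G (fromMatrix M) ×-dec (∣E fromMatrix M ∣ ℕ.≟ suc B))
... | yes (M , free , ∣E∣≡) = suc B , (fromMatrix M , free , ∣E∣≡) , bound
... | no ¬attained = maximum-exists H G Γ₀ free₀ B λ Γ free →
  ℕ.≤-pred (ℕ.≤∧≢⇒< (bound Γ free) λ ∣E∣≡ → ¬attained
    (toMatrix Γ , Free-resp-≈ {H = H} {G} {Γ} {fromMatrix (toMatrix Γ)} (toMatrix-≈ Γ) free ,
      trans (sym (∣E∣-cong {Γ = Γ} {fromMatrix (toMatrix Γ)} (toMatrix-≈ Γ))) ∣E∣≡))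

empty : ∀ n → Graph n
empty n = record
  { _~_ = λ _ _ → ⊥ ; _~?_ = λ _ _ → no λ () ; ~-sym = λ () ; ~-irrefl = λ _ () }

empty-free : ∀ {n k s} (3≤k : 3 ≤ k) → Free (C k 3≤k) (K₁ (suc s)) (empty n)
empty-free (s≤s (s≤s (s≤s z≤n))) =
  (λ (_ , _ , hom) → hom zero (suc zero) (inj₁ (inj₁ refl))) ,
  (λ (_ , _ , emb) → Equivalence.to (emb zero (suc zero)) (inj₁ (refl , λ ())))

-- Cyclic groups acting without short relations

rotate : ∀ {r} → ℕ → Fin (suc r) → Fin (suc r)
rotate {r} e x = (toℕ x + e) mod suc r

toℕ-rotate : ∀ {r} e (x : Fin (suc r)) → toℕ (rotate e x) ≡ (toℕ x + e) % suc r
toℕ-rotate {r} e x = toℕ-fromℕ< (m%n<n (toℕ x + e) (suc r))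

%-+ˡ : ∀ m n d → (m % suc d + n) % suc d ≡ (m + n) % suc d
%-+ˡ m n d = begin
  (m % suc d + n) % suc d                   ≡⟨ %-distribˡ-+ (m % suc d) n (suc d) ⟩
  (m % suc d % suc d + n % suc d) % suc d   ≡⟨ cong (λ z → (z + n % suc d) % suc d) (m%n%n≡m%n m (suc d)) ⟩
  (m % suc d + n % suc d) % suc d           ≡⟨ %-distribˡ-+ m n (suc d) ⟨
  (m + n) % suc d                           ∎
  where open ≡-Reasoning

rotate-+ : ∀ {r} e f (x : Fin (suc r)) → rotate e (rotate f x) ≡ rotate (e + f) x
rotate-+ {r} e f x = toℕ-injective (begin
  toℕ (rotate e (rotate f x))             ≡⟨ toℕ-rotate e (rotate f x) ⟩
  (toℕ (rotate f x) + e) % suc r         ≡⟨ cong (λ z → (z + e) % suc r) (toℕ-rotate f x) ⟩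
  ((toℕ x + f) % suc r + e) % suc r     ≡⟨ %-+ˡ (toℕ x + f) e r ⟩
  (toℕ x + f + e) % suc r               ≡⟨ cong (_% suc r) (trans (ℕ.+-assoc (toℕ x) f e) (cong (toℕ x +_) (ℕ.+-comm f e))) ⟩
  (toℕ x + (e + f)) % suc r             ≡⟨ toℕ-rotate (e + f) x ⟨
  toℕ (rotate (e + f) x)                 ∎)
  where open ≡-Reasoning

rotate-period : ∀ {r} (x : Fin (suc r)) → rotate (suc r) x ≡ x
rotate-period {r} x = toℕ-injective
  (trans (toℕ-rotate (suc r) x)
  (trans ([m+n]%n≡m%n (toℕ x) (suc r)) (m<n⇒m%n≡m (toℕ<n x))))

rotate-≢ : ∀ {r} (e : Fin r) (x : Fin (suc r)) → rotate (suc (toℕ e)) x ≢ x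
rotate-≢ {r} e x eq = ℕ.1+n≢0 (trans (sym (m<n⇒m%n≡m (s≤s (toℕ<n e)))) e%r≡0)
  where
  open ≡-Reasoning
  a = toℕ x
  b = suc (toℕ e)
  -- c is the additive inverse of x, which cancels x in (x + b) % suc r ≡ x.
  c = suc r ∸ a
  a+c : a + c ≡ suc r
  a+c = ℕ.m+[n∸m]≡n (ℕ.<⇒≤ (toℕ<n x))
  e%r≡0 : b % suc r ≡ 0
  e%r≡0 = begin
    b % suc r                   ≡⟨ [m+n]%n≡m%n b (suc r) ⟨
    (b + suc r) % suc r         ≡⟨ cong (λ z → (b + z) % suc r) a+c ⟨
    (b + (a + c)) % suc r       ≡⟨ cong (_% suc r) (trans (sym (ℕ.+-assoc b a c)) (cong (_+ c) (ℕ.+-comm b a))) ⟩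
    (a + b + c) % suc r         ≡⟨ %-+ˡ (a + b) c r ⟨
    ((a + b) % suc r + c) % suc r ≡⟨ cong (λ z → (z + c) % suc r) (trans (sym (toℕ-rotate b x)) (cong toℕ eq)) ⟩
    (a + c) % suc r             ≡⟨ cong (_% suc r) a+c ⟩
    suc r % suc r               ≡⟨ [m+n]%n≡m%n 0 (suc r) ⟩
    0                           ∎

-- Reduced words in the free product of d cyclic groups of order r + 1, indexed
-- by length, first colour and last colour; e : Fin r is the exponent e + 1.
data Word (d r : ℕ) : ℕ → Fin d → Fin d → Set where
  letter : ∀ i → Fin r → Word d r 1 i i
  snoc   : ∀ {l h i} → Word d r l h i → ∀ j → j ≢ i → Fin r → Word d r (suc l) h j

run : ∀ {d r l h i} {V : Set} → (Fin d → ℕ → V → V) → Word d r l h i → V → V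
run act (letter i e)     v = act i (suc (toℕ e)) v
run act (snoc w j _ e) v = act j (suc (toℕ e)) (run act w v)

-- `snoc` adds the letter applied last, whereas the covering argument has to detach the one applied
-- first. The remaining word has length `l` and starts in another colour.
uncons : ∀ {d r l h i} (w : Word d r l h i) j (j≢i : j ≢ i) e →
  ∃[ f ] ∃[ g ] g ≢ h × Σ[ w′ ∈ Word d r l g j ]
    (∀ {V : Set} (act : Fin d → ℕ → V → V) v →
      run act (snoc w j j≢i e) v ≡ run act w′ (act h f v))
uncons (letter h f) j j≢h e = suc (toℕ f) , j , j≢h , letter j e , λ _ _ → refl
uncons (snoc w i i≢h′ f) j j≢i e
  with f′ , g , g≢h , w′ , eq ← uncons w i i≢h′ f =
  f′ , g , g≢h , snoc w′ j j≢i e , λ act v → cong (act j _) (eq act v)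

-- The exponents of the actions live in the cyclic group of order r + 1.  The map
-- line i is constant on the orbits of the i-th action but may identify orbits.
record System (d r m N : ℕ) : Set₁ where
  field
    V Q        : Set
    V-finite   : Finite V
    Q-finite   : Finite Q
    large      : N < proj₁ V-finite
    act        : Fin d → ℕ → V → V
    act-+      : ∀ i e f v → act i e (act i f v) ≡ act i (e + f) v
    act-period : ∀ i v → act i (suc r) v ≡ v
    line       : Fin d → V → Q
    line-act   : ∀ i e v → line i (act i e v) ≡ line i v
    -- This asks more than that short words have no fixed points. It provides the induction: a walk
    -- that leaves a line does not come back to it too soon, so in the covering the counter of that
    -- line stays put.
    separated  : ∀ {l h i j} (w : Word d r l h i) v → l ≤ m → j ≢ h →
                 line j v ≢ line j (run act w v)

-- Every word has length at least 1, so separation is vacuous for `m = 0` and the number of points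
-- can be chosen above `N`.
trivial : ∀ d r N → System d r 0 N
trivial d r N = record
  { V          = Fin (suc N)
  ; Q          = ⊤
  ; V-finite   = suc N , ↔-id _
  ; Q-finite   = 1 , ↔-sym 1↔⊤
  ; large      = ℕ.≤-refl
  ; act        = λ _ _ v → v
  ; act-+      = λ _ _ _ _ → refl
  ; act-period = λ _ _ → refl
  ; line       = λ _ _ → tt
  ; line-act   = λ _ _ _ → refl
  ; separated  = λ { (letter _ _) _ () ; (snoc _ _ _ _) _ () }
  }

-- One counter modulo `r + 1` for each of the `d` colours and each of the `q` lines.
Table : (d r q : ℕ) → Set
Table d r q = Vec (Vec (Fin (suc r)) q) d

module _ {d r q : ℕ} where

  entry : Fin d → Fin q → Table d r q → Fin (suc r)
  entry i p c = Vec.lookup (Vec.lookup c i) p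

  bump : Fin d → Fin q → ℕ → Table d r q → Table d r q
  bump i p e c = Vec.updateAt c i (λ row → Vec.updateAt row p (rotate e))

  entry-bump : ∀ i p e c → entry i p (bump i p e c) ≡ rotate e (entry i p c)
  entry-bump i p e c =
    trans (cong (λ row → Vec.lookup row p) (lookup∘updateAt i c))
          (lookup∘updateAt p (Vec.lookup c i))

  entry-bump-≢ : ∀ {i j p p′} e c → (i ≢ j ⊎ p ≢ p′) →
    entry i p (bump j p′ e c) ≡ entry i p c
  entry-bump-≢ {i} {j} {p} e c (inj₁ i≢j) =
    cong (λ row → Vec.lookup row p) (lookup∘updateAt′ i j i≢j c)
  entry-bump-≢ {i} {j} {p} {p′} e c (inj₂ p≢p′) with i ≟ j
  ... | yes refl = trans (cong (λ row → Vec.lookup row p) (lookup∘updateAt i c))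
                         (lookup∘updateAt′ p p′ p≢p′ (Vec.lookup c i))
  ... | no i≢j   = entry-bump-≢ {p = p} {p′ = p′} e c (inj₁ i≢j)

  bump-+ : ∀ i p e f c → bump i p e (bump i p f c) ≡ bump i p (e + f) c
  bump-+ i p e f c = updateAt-updateAt-local i c
    (updateAt-updateAt-local p (Vec.lookup c i) (rotate-+ e f (entry i p c)))

  bump-period : ∀ i p c → bump i p (suc r) c ≡ c
  bump-period i p c = updateAt-id-local i c
    (updateAt-id-local p (Vec.lookup c i) (rotate-period _))

  -- The `i`-th action changes only row `i`, so the other rows are constant on its orbits and serve
  -- as the line map of the covering. Zeroing the row keeps one codomain for all colours.
  erase : Fin d → Table d r q → Table d r q
  erase i c = Vec.updateAt c i (const (Vec.replicate q zero))

  erase-bump : ∀ i p e c → erase i (bump i p e c) ≡ erase i c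
  erase-bump i p e c = updateAt-updateAt i c

  entry-erase : ∀ {i j} p c → i ≢ j → entry i p (erase j c) ≡ entry i p c
  entry-erase {i} {j} p c i≢j = cong (λ row → Vec.lookup row p) (lookup∘updateAt′ i j i≢j c)

-- A covering: every line carries a counter modulo r + 1, which records the
-- total exponent with which that line has been traversed.
module Cover {d r m N} (S : System d r m N) where
  open System S

  private
    q = proj₁ Q-finite

    counter : Fin d → V → Fin q
    counter i v = Inverse.to (proj₂ Q-finite) (line i v)

    counter-injective : ∀ {i v w} → counter i v ≡ counter i w → line i v ≡ line i w
    counter-injective = Injection.injective (↔⇒↣ (proj₂ Q-finite))

  V⁺ : Set
  V⁺ = V × Table d r q

  act⁺ : Fin d → ℕ → V⁺ → V⁺
  act⁺ i e (v , c) = act i e v , bump i (counter i v) e c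

  act⁺-+ : ∀ i e f x → act⁺ i e (act⁺ i f x) ≡ act⁺ i (e + f) x
  act⁺-+ i e f (v , c)
    -- The first move stays on its line, so both moves bump the same counter.
    rewrite line-act i f v | bump-+ i (counter i v) e f c = cong (_, _) (act-+ i e f v)

  run⁺ : ∀ {l h i} (w : Word d r l h i) x → proj₁ (run act⁺ w x) ≡ run act w (proj₁ x)
  run⁺ (letter _ _)   x = refl
  run⁺ (snoc w j _ e) x = cong (act j _) (run⁺ w x)

  -- The first letter stays on its line of colour `h`. The rest of the word starts in a colour other
  -- than `h`, so separation in the given system applies to it.
  no-return : ∀ {l h i} (w : Word d r l h i) v → l ≤ m → i ≢ h →
    line h v ≢ line h (run act w v)
  no-return (letter _ _) v l≤m i≢h = contradiction refl i≢h
  no-return {h = h} (snoc w j j≢i e) v l<m _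
    with f , g , g≢h , w′ , eq ← uncons w j j≢i e
    rewrite eq act v | sym (line-act h f v) =
    separated w′ (act h f v) (ℕ.<⇒≤ l<m) (g≢h ∘ sym)

  -- The line traversed first is never traversed again, so its counter moves once.
  first-counter : ∀ {l h i} (w : Word d r l h i) x → l ≤ suc m →
    entry h (counter h (proj₁ x)) (proj₂ (run act⁺ w x)) ≢
    entry h (counter h (proj₁ x)) (proj₂ x)
  first-counter (letter i e) (v , c) _ eq =
    rotate-≢ e _ (trans (sym (entry-bump i (counter i v) _ c)) eq)
  first-counter {h = h} (snoc {i = i} w j j≢i e) x (s≤s l≤m) eq =
    first-counter w x (ℕ.m≤n⇒m≤1+n l≤m) (trans (sym (entry-bump-≢ _ (proj₂ (run act⁺ w x)) untouched)) eq)
    where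
    untouched : h ≢ j ⊎ counter h (proj₁ x) ≢ counter j (proj₁ (run act⁺ w x))
    untouched with h ≟ j
    ... | no h≢j   = inj₁ h≢j
    -- The next letter has colour `h`, so the word before it ends in a colour other than `h` and
    -- cannot have come back to the first line.
    ... | yes refl = inj₂ λ eq′ → no-return w (proj₁ x) l≤m (j≢i ∘ sym)
                       (trans (counter-injective eq′) (cong (line h) (run⁺ w x)))

  -- Erasing row `j` keeps row `h`, which holds the counter that has changed.
  separated⁺ : ∀ {l h i j} (w : Word d r l h i) x → l ≤ suc m → j ≢ h →
    erase j (proj₂ x) ≢ erase j (proj₂ (run act⁺ w x))
  separated⁺ {h = h} {j = j} w x l≤1+m j≢h eq = first-counter w x l≤1+m (begin
    entry h p (proj₂ (run act⁺ w x))            ≡⟨ entry-erase p (proj₂ (run act⁺ w x)) (j≢h ∘ sym) ⟨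
    entry h p (erase j (proj₂ (run act⁺ w x)))  ≡⟨ cong (entry h p) eq ⟨
    entry h p (erase j (proj₂ x))               ≡⟨ entry-erase p (proj₂ x) (j≢h ∘ sym) ⟩
    entry h p (proj₂ x)                         ∎)
    where
    open ≡-Reasoning
    p = counter h (proj₁ x)

  cover : System d r (suc m) N
  cover = record
    { V          = V⁺
    ; Q          = Table d r q
    ; V-finite   = ×-finite V-finite Table-finite
    ; Q-finite   = Table-finite
    -- The zero table shows that the second factor is nonempty, so the covering has at least as many
    -- points.
    ; large      = ℕ.<-≤-trans large (ℕ.m≤m*n _ _ ⦃ nonZeroIndex (Inverse.to (proj₂ Table-finite) (Vec.replicate d (Vec.replicate q zero))) ⦄)
    ; act        = act⁺
    ; act-+      = act⁺-+
    ; act-period = λ { i (v , c) → cong₂ _,_ (act-period i v) (bump-period i (counter i v) c) }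
    ; line       = λ i x → erase i (proj₂ x)
    ; line-act   = λ { i e (v , c) → erase-bump i (counter i v) e c }
    ; separated  = separated⁺
    }
    where
    Table-finite : Finite (Table d r q)
    Table-finite = Vec-finite (Vec-finite (suc r , ↔-id _) q) d

system : ∀ d r m N → System d r m N
system d r zero    N = trivial d r N
system d r (suc m) N = Cover.cover (system d r m N)

-- The graph of common orbits: no short cycle words, no large star, full degree

module CosetGraph {d r m N} (S : System (suc (suc d)) r m N) where
  open System S

  private
    D : ℕ
    D = suc (suc d)

  -- With at least two colours, some colour differs from the first one of `w`, and the line in that
  -- colour changes.
  run-≢ : ∀ {l h i} (w : Word D r l h i) v → l ≤ m → run act w v ≢ v
  run-≢ {h = zero}  w v l≤m eq = separated {j = suc zero} w v l≤m (λ ()) (cong (line _) (sym eq))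
  run-≢ {h = suc _} w v l≤m eq = separated {j = zero} w v l≤m (λ ()) (cong (line _) (sym eq))

  act-0 : ∀ i v → act i 0 v ≡ v
  act-0 i v = begin
    act i 0 v                  ≡⟨ cong (act i 0) (act-period i v) ⟨
    act i 0 (act i (suc r) v)  ≡⟨ act-+ i 0 (suc r) v ⟩
    act i (suc r) v            ≡⟨ act-period i v ⟩
    v                          ∎
    where open ≡-Reasoning

  act-multiple : ∀ i q v → act i (q * suc r) v ≡ v
  act-multiple i zero    v = act-0 i v
  act-multiple i (suc q) v = trans (sym (act-+ i (suc r) (q * suc r) v))
    (trans (act-period i _) (act-multiple i q v))

  -- Membership in a common orbit, which may be smaller than a fibre of `line i`.
  Collinear : Fin D → V → V → Set
  Collinear i u v = ∃[ e ] v ≡ act i e u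

  collinear-refl : ∀ {i u} → Collinear i u u
  collinear-refl {i} {u} = 0 , sym (act-0 i u)

  collinear-sym : ∀ {i u v} → Collinear i u v → Collinear i v u
  -- `e * r` is inverse to `e` modulo `r + 1`.
  collinear-sym {i} {u} (e , refl) = e * r , (begin
    u                             ≡⟨ act-multiple i e u ⟨
    act i (e * suc r) u           ≡⟨ cong (λ x → act i x u) (trans (ℕ.*-suc e r) (ℕ.+-comm e (e * r))) ⟩
    act i (e * r + e) u           ≡⟨ act-+ i (e * r) e u ⟨
    act i (e * r) (act i e u)     ∎)
    where open ≡-Reasoning

  collinear-trans : ∀ {i u v w} → Collinear i u v → Collinear i v w → Collinear i u w
  collinear-trans {i} (e , refl) (f , refl) = f + e , act-+ i f e _

  reduce : ∀ {i u v} → Collinear i u v → ∃[ e ] v ≡ act i (toℕ {suc r} e) u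
  reduce {i} {u} (e , refl) = e mod suc r , (begin
    act i e u                                         ≡⟨ cong (λ x → act i x u) (m≡m%n+[m/n]*n e (suc r)) ⟩
    act i (e % suc r + e / suc r * suc r) u           ≡⟨ act-+ i (e % suc r) (e / suc r * suc r) u ⟨
    act i (e % suc r) (act i (e / suc r * suc r) u)   ≡⟨ cong (act i (e % suc r)) (act-multiple i (e / suc r) u) ⟩
    act i (e % suc r) u                               ≡⟨ cong (λ x → act i x u) (toℕ-fromℕ< (m%n<n e (suc r))) ⟨
    act i (toℕ (e mod suc r)) u                       ∎)
    where open ≡-Reasoning

  step : ∀ {i u v} → Collinear i u v → u ≢ v → ∃[ e ] v ≡ act i (suc (toℕ {r} e)) u
  step {i} {u} u-v u≢v with reduce u-v
  ... | zero  , v≡u = contradiction (sym (trans v≡u (act-0 i u))) u≢v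
  ... | suc e , v≡  = e , v≡

  act-≢ : 1 ≤ m → ∀ i {e f} v → e < f → f < suc r → act i e v ≢ act i f v
  act-≢ 1≤m i {e} {f} v e<f (s≤s f≤r) eq = run-≢ (letter i (fromℕ< g<r)) (act i e v) 1≤m (begin
    act i (suc (toℕ (fromℕ< g<r))) (act i e v)  ≡⟨ cong (λ x → act i (suc x) (act i e v)) (toℕ-fromℕ< g<r) ⟩
    act i (suc g) (act i e v)                   ≡⟨ act-+ i (suc g) e v ⟩
    act i (suc g + e) v                         ≡⟨ cong (λ x → act i x v) (trans (sym (ℕ.+-suc g e)) (ℕ.m∸n+n≡m e<f)) ⟩
    act i f v                                   ≡⟨ eq ⟨
    act i e v                                   ∎)
    where
    open ≡-Reasoning
    -- The exponent wanted is `f - e`, and a letter stores its exponent minus one.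
    g = f ∸ suc e
    g<r : g < r
    g<r = ℕ.<-≤-trans (ℕ.∸-monoʳ-< {f} {suc e} {0} (s≤s z≤n) e<f) f≤r

  -- The state of a walk p 0 , p 1 , … , p a whose last edge has colour c: the
  -- edges of the last monochromatic stretch are merged into one.
  data Trail (p : ℕ → V) (a : ℕ) (c : Fin D) : Set where
    straight : (∀ b → b ≤ a → Collinear c (p 0) (p b)) → Trail p a c
    bent     : ∀ {b l h i} (w : Word D r l h i) → l ≤ b → 0 < b → b < a →
               p b ≡ run act w (p 0) → c ≢ i → Collinear c (p b) (p a) → Trail p a c

  module _ (p : ℕ → V) (2+r≤m : suc (suc r) ≤ m)
           (distinct : ∀ {a b} → a < b → b < suc (suc r) → p a ≢ p b)
           (edge : ∀ a → a < suc (suc r) → ∃[ c ] Collinear c (p a) (p (suc a)))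
           (closed : p (suc (suc r)) ≡ p 0) where

    -- An edge in the colour of the last stretch prolongs it. An edge in a new colour turns that
    -- stretch into a letter, nontrivial since its ends are distinct; hence the word stays reduced
    -- and no longer than the walk.
    trail : ∀ a → suc a < suc (suc r) → ∃[ c ] Trail p (suc a) c
    trail zero _ with c , p₀-p₁ ← edge 0 (s≤s z≤n) =
      c , straight λ { zero _ → collinear-refl ; (suc zero) _ → p₀-p₁ ; (suc (suc _)) (s≤s ()) }
    trail (suc a) 2+a<2+r
      with c , t ← trail a (ℕ.<⇒≤ 2+a<2+r) | c′ , e ← edge (suc a) (ℕ.<⇒≤ 2+a<2+r) with c′ ≟ c | t
    ... | yes refl | straight all = c , straight extended
      where
      extended : ∀ b → b ≤ suc (suc a) → Collinear c (p 0) (p b)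
      extended b b≤ with ℕ.m≤n⇒m<n∨m≡n b≤
      ... | inj₁ (s≤s b≤1+a) = all b b≤1+a
      ... | inj₂ refl        = collinear-trans (all (suc a) ℕ.≤-refl) e
    ... | yes refl | bent w l≤b 0<b b<a pb c≢i x =
      c , bent w l≤b 0<b (ℕ.m≤n⇒m≤1+n b<a) pb c≢i (collinear-trans x e)
    ... | no c′≢c | straight all
      with f , eq ← step (all (suc a) ℕ.≤-refl) (distinct (s≤s z≤n) (ℕ.<⇒≤ 2+a<2+r)) =
      c′ , bent (letter c f) (s≤s z≤n) (s≤s z≤n) ℕ.≤-refl eq c′≢c e
    ... | no c′≢c | bent w l≤b 0<b b<a pb c≢i x
      with f , eq ← step x (distinct b<a (ℕ.<⇒≤ 2+a<2+r)) =
      c′ , bent (snoc w c c≢i f) (ℕ.≤-trans (s≤s l≤b) b<a) (s≤s z≤n) ℕ.≤-refl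
             (trans eq (cong (act c _) pb)) c′≢c e

    -- An orbit has at most `r + 1` points, too few for the `r + 2` distinct vertices.
    not-straight : ∀ {c} → ¬ (∀ b → b ≤ suc r → Collinear c (p 0) (p b))
    not-straight {c} all =
      let x , y , x<y , eq = pigeonhole {suc r} ℕ.≤-refl exponent
      in distinct x<y (toℕ<n y) (begin
        p (toℕ x)                         ≡⟨ position x ⟩
        act c (toℕ (exponent x)) (p 0)    ≡⟨ cong (λ z → act c (toℕ z) (p 0)) eq ⟩
        act c (toℕ (exponent y)) (p 0)    ≡⟨ position y ⟨
        p (toℕ y)                         ∎)
      where
      open ≡-Reasoning
      exponent : Fin (suc (suc r)) → Fin (suc r)
      exponent x = proj₁ (reduce (all (toℕ x) (ℕ.≤-pred (toℕ<n x))))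
      position : ∀ x → p (toℕ x) ≡ act c (toℕ (exponent x)) (p 0)
      position x = proj₂ (reduce (all (toℕ x) (ℕ.≤-pred (toℕ<n x))))

    -- The closing edge prolongs the last stretch or becomes a letter of its own. Either way a
    -- reduced word of length at most `r + 2` fixes `p 0`; its first and last colours may agree.
    no-cycle : ⊥
    no-cycle with c , t ← trail r ℕ.≤-refl | c′ , e ← edge (suc r) ℕ.≤-refl with t
    ... | straight all = not-straight all
    ... | bent {b} w l≤b 0<b b<1+r pb c≢i x with c′ ≟ c
    ...   | yes refl
        with f , eq ← step (subst (Collinear c (p b)) closed (collinear-trans x e))
                           (distinct 0<b (ℕ.m≤n⇒m≤1+n b<1+r) ∘ sym) =
          run-≢ (snoc w c c≢i f) (p 0)
            (ℕ.≤-trans (s≤s l≤b) (ℕ.≤-trans b<1+r (ℕ.<⇒≤ 2+r≤m)))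
            (sym (trans eq (cong (act c _) pb)))
    ...   | no c′≢c
        with f , eq ← step x (distinct b<1+r ℕ.≤-refl)
           | g , eq′ ← step (subst (Collinear c′ (p (suc r))) closed e) (distinct (s≤s z≤n) ℕ.≤-refl ∘ sym) =
          run-≢ (snoc (snoc w c c≢i f) c′ c′≢c g) (p 0)
            (ℕ.≤-trans (s≤s (ℕ.≤-trans (s≤s l≤b) b<1+r)) 2+r≤m)
            (sym (trans eq′ (cong (act c′ _) (trans eq (cong (act c _) pb)))))

  n : ℕ
  n = proj₁ V-finite

  point : Fin n → V
  point = Inverse.from (proj₂ V-finite)

  index : V → Fin n
  index = Inverse.to (proj₂ V-finite)

  point-index : ∀ v → point (index v) ≡ v
  point-index = Inverse.strictlyInverseʳ (proj₂ V-finite)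

  point-injective : ∀ {x y} → point x ≡ point y → x ≡ y
  point-injective {x} {y} eq = trans (sym (Inverse.strictlyInverseˡ (proj₂ V-finite) x))
    (trans (cong index eq) (Inverse.strictlyInverseˡ (proj₂ V-finite) y))

  collinear? : ∀ i u v → Dec (Collinear i u v)
  collinear? i u v = map′ (λ (e , eq) → toℕ e , eq) reduce
    (any? λ e → via-injection (↔⇒↣ (proj₂ V-finite)) _≟_ v (act i (toℕ {suc r} e) u))

  graph : Graph n
  graph = record
    { _~_      = λ x y → x ≢ y × ∃[ i ] Collinear i (point x) (point y)
    ; _~?_     = λ x y → ¬? (x ≟ y) ×-dec any? (λ i → collinear? i (point x) (point y))
    ; ~-sym    = λ (x≢y , i , col) → x≢y ∘ sym , i , collinear-sym col
    ; ~-irrefl = λ x≡y (x≢y , _) → x≢y x≡y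
    }

  -- Two of the `D + 1` leaves are joined to the centre in the same colour, so they share an orbit
  -- and are adjacent.
  star-free : ¬ ContainsInduced (K₁ (suc D)) graph
  star-free (f , f-injective , emb) =
    let x , y , x<y , eq = pigeonhole (ℕ.n<1+n D) colour
    in nonadjacent (Equivalence.from (emb (suc x) (suc y))
         ( (λ eq′ → <⇒≢ x<y (suc-injective (f-injective eq′)))
         , colour x
         , collinear-trans (collinear-sym (proj₂ (proj₂ (leaf x))))
             (subst (λ c → Collinear c (point (f zero)) (point (f (suc y)))) (sym eq) (proj₂ (proj₂ (leaf y))))))
    where
    leaf : ∀ x → Graph._~_ graph (f zero) (f (suc x))
    leaf x = Equivalence.to (emb zero (suc x)) (inj₁ (refl , λ ()))
    colour : Fin (suc D) → Fin D
    colour x = proj₁ (proj₂ (leaf x))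
    nonadjacent : ∀ {x y} → ¬ Graph._~_ (K₁ (suc D)) (suc x) (suc y)
    nonadjacent (inj₁ (() , _))
    nonadjacent (inj₂ (() , _))

  cycle-free : suc (suc r) ≤ m → (3≤k : 3 ≤ suc (suc r)) → ¬ ContainsSubgraph (C (suc (suc r)) 3≤k) graph
  cycle-free 2+r≤m 3≤k (f , f-injective , hom) = no-cycle p 2+r≤m distinct edge closed
    where
    k = suc (suc r)
    p : ℕ → V
    -- Reading indices modulo `k` makes the closing edge an ordinary step, from `k - 1` to `k`.
    p a = point (f (a mod k))
    toℕ-mod : ∀ a → toℕ (a mod k) ≡ a % k
    toℕ-mod a = toℕ-fromℕ< (m%n<n a k)
    toℕ-mod-< : ∀ {a} → a < k → toℕ (a mod k) ≡ a
    toℕ-mod-< {a} a<k = trans (toℕ-mod a) (m<n⇒m%n≡m a<k)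
    toℕ-mod-k : toℕ (k mod k) ≡ 0
    toℕ-mod-k = trans (toℕ-mod k) (n%n≡0 k)
    closed : p k ≡ p 0
    closed = cong (point ∘ f) (toℕ-injective toℕ-mod-k)
    distinct : ∀ {a b} → a < b → b < k → p a ≢ p b
    distinct {a} {b} a<b b<k eq = ℕ.<⇒≢ a<b (begin
      a              ≡⟨ toℕ-mod-< (ℕ.<-trans a<b b<k) ⟨
      toℕ (a mod k)  ≡⟨ cong toℕ (f-injective (point-injective eq)) ⟩
      toℕ (b mod k)  ≡⟨ toℕ-mod-< b<k ⟩
      b              ∎)
      where open ≡-Reasoning
    next : ∀ a → a < k → Next {k} (a mod k) (suc a mod k)
    next a a<k with ℕ.m≤n⇒m<n∨m≡n a<k
    ... | inj₁ 1+a<k = inj₁ (trans (toℕ-mod-< 1+a<k) (cong suc (sym (toℕ-mod-< a<k))))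
    ... | inj₂ refl  = inj₂ (cong suc (toℕ-mod-< a<k) , toℕ-mod-k)
    edge : ∀ a → a < k → ∃[ c ] Collinear c (p a) (p (suc a))
    edge a a<k = proj₂ (hom _ _ (inj₁ (next a a<k)))

  -- For different colours, one letter followed by the inverse of the other would be a reduced word
  -- of length 2 fixing `v`.
  act-injective : 2 ≤ m → ∀ v {i j} {e f : Fin r} →
    act i (suc (toℕ e)) v ≡ act j (suc (toℕ f)) v → (i , e) ≡ (j , f)
  act-injective 2≤m v {i} {j} {e} {f} eq with i ≟ j
  ... | yes refl with ℕ.<-cmp (toℕ e) (toℕ f)
  ...   | tri< e<f _ _ = contradiction eq (act-≢ (ℕ.<⇒≤ 2≤m) i v (s≤s e<f) (s≤s (toℕ<n f)))
  ...   | tri≈ _ e≡f _ = cong (i ,_) (toℕ-injective e≡f)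
  ...   | tri> _ _ f<e = contradiction (sym eq) (act-≢ (ℕ.<⇒≤ 2≤m) i v (s≤s f<e) (s≤s (toℕ<n e)))
  act-injective 2≤m v {i} {j} {e} {f} eq | no i≢j
    with g , eq′ ← step (collinear-sym (suc (toℕ f) , eq)) (run-≢ (letter i e) v (ℕ.<⇒≤ 2≤m)) =
    contradiction (sym eq′) (run-≢ (snoc (letter i e) j (i≢j ∘ sym) g) v 2≤m)

  open Degree graph

  degree-≥ : 2 ≤ m → ∀ x → D * r ≤ degree x
  degree-≥ 2≤m x = injection⇒≤length neighbour neighbour-injective λ z →
    ∈-filter⁺ (Graph._~?_ graph x) (∈-allFin (neighbour z)) (adjacent z)
    where
    letters : Fin (D * r) → Fin D × Fin r
    letters = remQuot {D} r
    move : Fin D × Fin r → V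
    move (i , e) = act i (suc (toℕ e)) (point x)
    neighbour : Fin (D * r) → Fin n
    neighbour z = index (move (letters z))
    neighbour-injective : ∀ {y z} → neighbour y ≡ neighbour z → y ≡ z
    neighbour-injective {y} {z} eq = Injection.injective (↔⇒↣ (*↔× {D} {r}))
      (act-injective 2≤m (point x) {proj₁ (letters y)} {proj₁ (letters z)} (Injection.injective (↔⇒↣ (proj₂ V-finite)) eq))
    move-adjacent : ∀ i e → Graph._~_ graph x (index (move (i , e)))
    move-adjacent i e =
      (λ x≡ → run-≢ (letter i e) (point x) (ℕ.<⇒≤ 2≤m)
        (trans (sym (point-index (move (i , e)))) (cong point (sym x≡)))) ,
      i , suc (toℕ e) , point-index (move (i , e))
    adjacent : ∀ z → Graph._~_ graph x (neighbour z)
    adjacent z = move-adjacent (proj₁ (letters z)) (proj₂ (letters z))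

  edges-≥ : 2 ≤ m → r * D * n ≤ 2 * ∣E graph ∣
  edges-≥ 2≤m = begin
    r * D * n         ≡⟨ cong (_* n) (ℕ.*-comm r D) ⟩
    D * r * n         ≡⟨ ℕ.*-comm (D * r) n ⟩
    n * (D * r)       ≤⟨ sum-≥ degree (degree-≥ 2≤m) ⟩
    _                 ≡⟨ handshake ⟩
    2 * ∣E graph ∣    ∎
    where open ℕ.≤-Reasoning

-- Assembling the bound and the extremal graphs

theorem4 : ∀ (t k : ℕ) → 3 ≤ t → (3≤k : 3 ≤ k) →
    (∀ n → 1 ≤ n →
    ∃[ m ] (IsEx n (C k 3≤k) (K₁ t) m × 2 * m ≤ (k ∸ 2) * (t ∸ 1) * n)) ×
    (∀ N → ∃[ n ] (N < n ×
    ∃[ m ] (IsEx n (C k 3≤k) (K₁ t) m × 2 * m ≡ (k ∸ 2) * (t ∸ 1) * n)))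
theorem4 (suc (suc (suc d))) k@(suc (suc r)) (s≤s (s≤s (s≤s _))) 3≤k@(s≤s (s≤s _)) = upper , λ N → attained N
  where
  s = suc (suc d)

  upper : ∀ n → 1 ≤ n → ∃[ m ] (IsEx n (C k 3≤k) (K₁ (suc s)) m × 2 * m ≤ r * s * n)
  upper n _
    with maximum-exists (C k 3≤k) (K₁ (suc s)) (empty n) (empty-free 3≤k) (r * s * n)
           (λ Γ free → ℕ.≤-trans (ℕ.m≤m+n _ _) (edges-≤ Γ r s 3≤k free))
  ... | m , isEx@((Γ , free , refl) , _) = m , isEx , edges-≤ Γ r s 3≤k free

  attained : ∀ N → ∃[ n ] (N < n × ∃[ m ] (IsEx n (C k 3≤k) (K₁ (suc s)) m × 2 * m ≡ r * s * n))
  attained N = n , System.large S , ∣E graph ∣ , ((graph , free , refl) , maximal) , tight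
    where
    -- `t - 1` actions of the cyclic group of order `k - 1`, separated for words up to the length
    -- `k` of the forbidden cycle.
    S = system s r k N
    open CosetGraph S
    free : Free (C k 3≤k) (K₁ (suc s)) graph
    free = cycle-free ℕ.≤-refl 3≤k , star-free
    tight : 2 * ∣E graph ∣ ≡ r * s * n
    tight = ℕ.≤-antisym (edges-≤ graph r s 3≤k free) (edges-≥ (s≤s (s≤s z≤n)))
    maximal : ∀ Γ → Free (C k 3≤k) (K₁ (suc s)) Γ → ∣E Γ ∣ ≤ ∣E graph ∣
    maximal Γ Γ-free = ℕ.*-cancelˡ-≤ 2 (ℕ.≤-trans (edges-≤ Γ r s 3≤k Γ-free) (ℕ.≤-reflexive (sym tight)))
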